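{- Let $n\ge3$, $\alpha=(\alpha_2,\dots,\alpha_{n-1})$ positive integers, $N>|\alpha|$, $L=N-|\alpha|$, and $2\le\ell\le n$. There exists a bijection $\phi:W^>\to W^{\le}$ such that: (1) $\phi$ maps $W_k^>$ bijectively onto $W_{k+1}^{\le}$ for each $0\le k\le L-1$; (2) $\mathrm{quinv}'(\phi(w))=\mathrm{quinv}'(w)$ for all $w\in W^>$; (3) the subword of $w$ consisting of the letters $2,\dots,n-1$ equals the corresponding subword of $\phi(w)$.
   Context: $|\alpha|=\sum_i\alpha_i$. For $0\le k\le L$, $W_k$ is the set of words $w=(w_1,\dots,w_N)$ over $\{1,\dots,n\}$ containing exactly $k$ letters $n$, exactly $L-k$ letters $1$, and exactly $\alpha_i$ letters $i$ for $2\le i\le n-1$. $\mathrm{coinv}(w)=\#\{(i,j):i<j,\ w_i<w_j\}$ and $\mathrm{quinv}'(w)=\mathrm{coinv}(w)+\binom{\alpha_\ell}{2}+\cdots+\binom{\alpha_{n-1}}{2}+\binom{k}{2}$ for $w\in W_k$ (the middle sum is empty if $\ell=n$). For $w\in W_k$ let $p_n(w)$ be the position, from the left, of the leftmost $n$ in $w$, and $p_1(w)$ the position, counted from the right, of the rightmost $1$ in the word obtained from $w$ by deleting all $n$'s. $W_k^{\le}$ (resp. $W_k^>$) is the set of $w\in W_k$ with $p_n(w)\le p_1(w)$ (resp. $p_n(w)>p_1(w)$), with the conventions $W_0=W_0^>$ and $W_L=W_L^{\le}$. $W^{\le}=\bigcup_kW_k^{\le}$ and $W^>=\bigcup_kW_k^>$.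 -}

module Defs where

open import Level using (0ℓ)
open import Data.Nat using (ℕ; suc; _+_; _∸_; _≤_; _<_; _>_; _≟_; _≤?_; _<?_)
open import Data.Nat.Combinatorics using (_C_)
open import Data.Fin using (Fin; toℕ)
open import Data.List as List using (List; length; filter; takeWhile; reverse; cartesianProduct; allFin)
open import Data.Nat.ListAction using (sum)
open import Data.Vec as Vec using (Vec; lookup; count; toList)
open import Data.Product using (Σ; _×_; _,_; proj₁; Σ-syntax)
open import Data.Sum using (_⊎_)
open import Relation.Nullary using (¬?; _×-dec_)
open import Relation.Unary using (Pred; ⋃)
open import Relation.Binary.Bundles using (Setoid)
open import Relation.Binary.PropositionalEquality using (_≡_; setoid)
import Relation.Binary.Construct.On as On

-- A subset P of A as a setoid: elements are compared in A, ignoring the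
-- membership proofs.
SubsetSetoid : {A : Set} → Pred A 0ℓ → Setoid 0ℓ 0ℓ
SubsetSetoid {A} P = On.setoid (setoid A) (proj₁ {B = P})

record MapsBijectivelyOnto {A B : Set} {P : Pred A 0ℓ} {Q : Pred B 0ℓ}
                           (f : Σ A P → Σ B Q) (S : Pred A 0ℓ) (T : Pred B 0ℓ) : Set where
  field
    mapsTo     : ∀ x → S (proj₁ x) → T (proj₁ (f x))
    injective  : ∀ x y → S (proj₁ x) → S (proj₁ y) →
                 proj₁ (f x) ≡ proj₁ (f y) → proj₁ x ≡ proj₁ y
    surjective : ∀ b → T b → Σ[ x ∈ Σ A P ] (S (proj₁ x) × proj₁ (f x) ≡ b)

-- The entry of α at index j is α_{2+j}, so α = (α₂, …, α_{n-1}).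
module Words (n N : ℕ) (α : Vec ℕ (n ∸ 2)) where

  Word : Set
  Word = Vec (Fin n) N

  -- Fin n stands for the alphabet {1, …, n}.
  letter : Fin n → ℕ
  letter a = suc (toℕ a)

  L : ℕ
  L = N ∸ Vec.sum α

  #[_] : ℕ → Word → ℕ
  #[ i ] w = count (λ a → letter a ≟ i) w

  record W[_] (k : ℕ) (w : Word) : Set where
    field
      k≤L     : k ≤ L
      count-n : #[ n ] w ≡ k
      count-1 : #[ 1 ] w ≡ L ∸ k
      count-i : ∀ (j : Fin (n ∸ 2)) → #[ 2 + toℕ j ] w ≡ lookup α j

  coinv : Word → ℕ
  coinv w = length (filter (λ (i , j) → (toℕ i <? toℕ j) ×-dec (letter (lookup w i) <? letter (lookup w j)))
                           (cartesianProduct (allFin N) (allFin N)))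

  -- For w ∈ W_k the number #[ n ] w is k.
  quinv′ : (ℓ : ℕ) → Word → ℕ
  quinv′ ℓ w = coinv w
             + sum (List.map (λ j → lookup α j C 2)
                                  (filter (λ j → ℓ ≤? 2 + toℕ j) (allFin (n ∸ 2))))
             + (#[ n ] w) C 2

  -- The 1-based position of the first occurrence of the letter i.  If i does
  -- not occur this is a junk value, which W≤[_] and W>[_] never consult.
  firstPosition : ℕ → List (Fin n) → ℕ
  firstPosition i as = suc (length (takeWhile (λ a → ¬? (letter a ≟ i)) as))

  pₙ : Word → ℕ
  pₙ w = firstPosition n (toList w)

  p₁ : Word → ℕ
  p₁ w = firstPosition 1 (reverse (filter (λ a → ¬? (letter a ≟ n)) (toList w)))

  -- The first disjuncts are the conventions W_L = W_L^≤ and W_0 = W_0^>.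
  W≤[_] : ℕ → Pred Word 0ℓ
  W≤[ k ] w = W[ k ] w × (k ≡ L ⊎ (0 < k × k < L × pₙ w ≤ p₁ w))

  W>[_] : ℕ → Pred Word 0ℓ
  W>[ k ] w = W[ k ] w × (k ≡ 0 ⊎ (0 < k × k < L × pₙ w > p₁ w))

  W≤ : Pred Word 0ℓ
  W≤ = ⋃[ k ∶ ℕ ] W≤[ k ]

  W> : Pred Word 0ℓ
  W> = ⋃[ k ∶ ℕ ] W>[ k ]

  middleSubword : Word → List (Fin n)
  middleSubword w = filter (λ a → (2 ≤? letter a) ×-dec (letter a ≤? n ∸ 1)) (toList w)

{-# OPTIONS --safe #-}

-- Encode a word w by the set S of 0-based positions of its letters n together
-- with the word u left after deleting them.  Each n is larger than every letter
-- of u, so coinv(w) + C(k,2) = coinv(u) + ΣS.  If exactly q letters follow the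
-- last 1 of u, deleting that 1 lowers coinv(u) by q; adding q to S restores the
-- total.  The condition p_n > p_1 says that q is smaller than every element of
-- S, so q is recovered as the new minimum of S; afterwards the last q letters of
-- u contain no 1, i.e. p_n ≤ p_1, and putting a 1 in front of them inverts the map.

module Submission where

open import Defs
open import Level using (0ℓ)
open import Data.Bool using (Bool; true; false)
open import Data.Fin using (Fin; zero; suc; toℕ; fromℕ)
open import Data.Fin.Properties using (toℕ-fromℕ; toℕ-injective; toℕ≤pred[n]; toℕ<n)
open import Data.List as List using (List; []; _∷_; _++_; length; filter; takeWhile; reverse; replicate; tabulate; cartesianProduct; allFin)
open import Data.List.Properties
open import Data.List.Relation.Unary.All as ListAll using ([]; _∷_)
open import Data.List.Relation.Unary.All.Properties using (all⇒takeWhile≗id; ++⁺; ++⁻ˡ; ++⁻ʳ; filter⁺)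
open import Data.Nat using (ℕ; zero; suc; _+_; _∸_; _≤_; _<_; z≤n; s≤s; s≤s⁻¹; _≟_; _≤?_; _<?_)
open import Data.Nat.Combinatorics using (_C_; nCk+nC[k+1]≡[n+1]C[k+1]; nC1≡n)
import Data.Nat.ListAction as ListAction
open import Data.Nat.Properties hiding (_≟_; _≤?_; _<?_)
open import Data.Nat.Tactic.RingSolver using (solve-∀)
open import Data.Product using (_×_; _,_; proj₁; proj₂; Σ-syntax; ∃; ∃-syntax)
open import Data.Sum using (_⊎_; inj₁; inj₂)
open import Data.Vec as Vec using (Vec; []; _∷_; sum; toList; lookup)
open import Data.Vec.Properties using (cast-is-id; toList-injective; toList∘fromList; length-toList)
open import Data.Vec.Relation.Unary.All using (All)
open import Function using (_∘_; id)
open import Function.Bundles using (Bijection)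
open import Relation.Binary.PropositionalEquality
open import Relation.Nullary using (¬_; Dec; yes; no; ¬?; _×-dec_; contradiction)
open import Relation.Unary using (Pred; Decidable)

private variable
  X Y : Set

-- Lists

takeWhile-accept : ∀ {P : Pred X 0ℓ} (P? : Decidable P) {x xs} → P x →
                   takeWhile P? (x ∷ xs) ≡ x ∷ takeWhile P? xs
takeWhile-accept P? {x} px with P? x
... | yes _  = refl
... | no ¬px = contradiction px ¬px

takeWhile-reject : ∀ {P : Pred X 0ℓ} (P? : Decidable P) {x xs} → ¬ P x →
                   takeWhile P? (x ∷ xs) ≡ []
takeWhile-reject P? {x} ¬px with P? x
... | yes px = contradiction px ¬px
... | no _   = refl

takeWhile-++ : ∀ {P : Pred X 0ℓ} (P? : Decidable P) {xs} ys → ListAll.All P xs →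
               takeWhile P? (xs ++ ys) ≡ xs ++ takeWhile P? ys
takeWhile-++ P? ys []         = refl
takeWhile-++ P? ys (px ∷ pxs) =
  trans (takeWhile-accept P? px) (cong (_ ∷_) (takeWhile-++ P? ys pxs))

-- Applied below to a reversed word with `P` meaning "not 1": it cuts off the last `q` letters
-- together with a proof that none of them is 1.
≤-takeWhile⇒prefix : ∀ {P : Pred X 0ℓ} (P? : Decidable P) xs {q} → q ≤ length (takeWhile P? xs) →
                     ∃[ ys ] ∃[ zs ] (xs ≡ ys ++ zs × length ys ≡ q × ListAll.All P ys)
≤-takeWhile⇒prefix P? xs       {zero}  _ = [] , xs , refl , refl , []
≤-takeWhile⇒prefix P? (x ∷ xs) {suc q} q≤ with P? x
≤-takeWhile⇒prefix P? (x ∷ xs) {suc q} (s≤s q≤) | yes px =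
  let ys , zs , eq , len , pys = ≤-takeWhile⇒prefix P? xs q≤
  in x ∷ ys , zs , cong (x ∷_) eq , cong suc len , px ∷ pys

reverse⁺ : ∀ {P : Pred X 0ℓ} {xs} → ListAll.All P xs → ListAll.All P (reverse xs)
reverse⁺         []                 = []
reverse⁺ {P = P} {x ∷ xs} (px ∷ pxs) =
  subst (ListAll.All P) (sym (unfold-reverse x xs)) (++⁺ (reverse⁺ pxs) (px ∷ []))

filter-++-reject : ∀ {P : Pred X 0ℓ} (P? : Decidable P) xs {y ys} → ¬ P y →
                   filter P? (xs ++ y ∷ ys) ≡ filter P? (xs ++ ys)
filter-++-reject P? xs {y} {ys} ¬py = begin
  filter P? (xs ++ y ∷ ys)          ≡⟨ filter-++ P? xs (y ∷ ys) ⟩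
  filter P? xs ++ filter P? (y ∷ ys) ≡⟨ cong (filter P? xs ++_) (filter-reject P? ¬py) ⟩
  filter P? xs ++ filter P? ys      ≡⟨ filter-++ P? xs ys ⟨
  filter P? (xs ++ ys)              ∎
  where open ≡-Reasoning

length-filter-++-accept : ∀ {P : Pred X 0ℓ} (P? : Decidable P) xs {y ys} → P y →
                          length (filter P? (xs ++ y ∷ ys)) ≡ suc (length (filter P? (xs ++ ys)))
length-filter-++-accept P? xs {y} {ys} py = begin
  length (filter P? (xs ++ y ∷ ys))               ≡⟨ cong length (filter-++ P? xs (y ∷ ys)) ⟩
  length (filter P? xs ++ filter P? (y ∷ ys))     ≡⟨ cong (λ zs → length (filter P? xs ++ zs)) (filter-accept P? py) ⟩
  length (filter P? xs ++ y ∷ filter P? ys)       ≡⟨ length-++-sucʳ (filter P? xs) y (filter P? ys) ⟩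
  suc (length (filter P? xs ++ filter P? ys))     ≡⟨ cong (suc ∘ length) (filter-++ P? xs ys) ⟨
  suc (length (filter P? (xs ++ ys)))             ∎
  where open ≡-Reasoning

-- Recovers the cut `A ++ B` from the length of `B` alone. In the mixed cases the two sides would
-- have different lengths.
++-injective-lengthʳ : ∀ (xs xs′ : List X) {ys ys′} → length ys ≡ length ys′ →
                       xs ++ ys ≡ xs′ ++ ys′ → xs ≡ xs′ × ys ≡ ys′
++-injective-lengthʳ []       []         _  eq = refl , eq
++-injective-lengthʳ (x ∷ xs) (x′ ∷ xs′) le eq with ++-injective-lengthʳ xs xs′ le (∷-injectiveʳ eq)
... | refl , refl = cong (_∷ xs) (∷-injectiveˡ eq) , refl
++-injective-lengthʳ []       (x′ ∷ xs′) {ys} {ys′} le eq =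
  contradiction (trans (sym le) (trans (cong length eq) (length-++ (x′ ∷ xs′)))) (m≢1+n+m (length ys′))
++-injective-lengthʳ (x ∷ xs) []         {ys} {ys′} le eq =
  contradiction (trans le (trans (sym (cong length eq)) (length-++ (x ∷ xs)))) (m≢1+n+m (length ys))

length-filter-∷ : ∀ {P : Pred X 0ℓ} (P? : Decidable P) x xs ys {k} →
                  length (filter P? xs) ≡ length (filter P? ys) + k →
                  length (filter P? (x ∷ xs)) ≡ length (filter P? (x ∷ ys)) + k
length-filter-∷ P? x xs ys eq with P? x
... | yes _ = cong suc eq
... | no _  = eq

length-filter≡0⇒All¬ : ∀ {P : Pred X 0ℓ} (P? : Decidable P) xs →
                       length (filter P? xs) ≡ 0 → ListAll.All (¬_ ∘ P) xs
length-filter≡0⇒All¬ P? []       _  = []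
length-filter≡0⇒All¬ P? (x ∷ xs) eq with P? x
... | no ¬px = ¬px ∷ length-filter≡0⇒All¬ P? xs eq

takeWhile≤filter : ∀ {P : Pred X 0ℓ} (P? : Decidable P) xs →
                   length (takeWhile P? xs) ≤ length (filter P? xs)
takeWhile≤filter P? []       = z≤n
takeWhile≤filter P? (x ∷ xs) with P? x
... | yes _ = s≤s (takeWhile≤filter P? xs)
... | no _  = z≤n

length-filter-map : ∀ {P : Pred Y 0ℓ} (P? : Decidable P) (f : X → Y) xs →
                    length (filter P? (List.map f xs)) ≡ length (filter (P? ∘ f) xs)
length-filter-map P? f []       = refl
length-filter-map P? f (x ∷ xs) with P? (f x)
... | yes _ = cong suc (length-filter-map P? f xs)
... | no _  = length-filter-map P? f xs

length-filter-cartesianProduct : ∀ {P : Pred (X × Y) 0ℓ} (P? : Decidable P) xs ys →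
  length (filter P? (cartesianProduct xs ys)) ≡
  ListAction.sum (List.map (λ x → length (filter (λ y → P? (x , y)) ys)) xs)
length-filter-cartesianProduct P? []       ys = refl
length-filter-cartesianProduct P? (x ∷ xs) ys = begin
  length (filter P? (List.map (x ,_) ys ++ cartesianProduct xs ys))
    ≡⟨ cong length (filter-++ P? (List.map (x ,_) ys) _) ⟩
  length (filter P? (List.map (x ,_) ys) ++ filter P? (cartesianProduct xs ys))
    ≡⟨ length-++ (filter P? (List.map (x ,_) ys)) ⟩
  length (filter P? (List.map (x ,_) ys)) + length (filter P? (cartesianProduct xs ys))
    ≡⟨ cong₂ _+_ (length-filter-map P? (x ,_) ys) (length-filter-cartesianProduct P? xs ys) ⟩
  _ ∎
  where open ≡-Reasoning

length-filter-allFin-suc : ∀ {N} {P : Pred (Fin (suc N)) 0ℓ} (P? : Decidable P) → ¬ P zero →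
  length (filter P? (allFin (suc N))) ≡ length (filter (P? ∘ suc) (allFin N))
length-filter-allFin-suc {N} P? ¬p0 = begin
  length (filter P? (zero ∷ tabulate suc))     ≡⟨ cong length (filter-reject P? ¬p0) ⟩
  length (filter P? (tabulate suc))            ≡⟨ cong (length ∘ filter P?) (map-tabulate id suc) ⟨
  length (filter P? (List.map suc (allFin N))) ≡⟨ length-filter-map P? suc (allFin N) ⟩
  length (filter (P? ∘ suc) (allFin N))        ∎
  where open ≡-Reasoning

map-lookup-allFin : ∀ {N} (w : Vec X N) → List.map (lookup w) (allFin N) ≡ toList w
map-lookup-allFin []      = refl
map-lookup-allFin (x ∷ w) = cong (x ∷_) (begin
  List.map (lookup (x ∷ w)) (tabulate suc) ≡⟨ map-tabulate suc (lookup (x ∷ w)) ⟩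
  tabulate (lookup w)                      ≡⟨ map-tabulate id (lookup w) ⟨
  List.map (lookup w) (allFin _)           ≡⟨ map-lookup-allFin w ⟩
  toList w                                 ∎)
  where open ≡-Reasoning

count≡length-filter : ∀ {P : Pred X 0ℓ} (P? : Decidable P) {N} (w : Vec X N) →
                      Vec.count P? w ≡ length (filter P? (toList w))
count≡length-filter P? []      = refl
count≡length-filter P? (x ∷ w) with P? x
... | yes _ = cong suc (count≡length-filter P? w)
... | no _  = count≡length-filter P? w

toList-surjective : ∀ {N} (xs : List X) → length xs ≡ N → ∃[ w ] toList {n = N} w ≡ xs
toList-surjective xs refl = Vec.fromList xs , toList∘fromList xs

toList-injective′ : ∀ {N} {w w′ : Vec X N} → toList w ≡ toList w′ → w ≡ w′
toList-injective′ {w = w} {w′} eq = trans (sym (cast-is-id refl w)) (toList-injective refl w w′ eq)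

suc-C2 : ∀ k → suc k C 2 ≡ k + k C 2
suc-C2 k = trans (sym (nCk+nC[k+1]≡[n+1]C[k+1] k 1)) (cong (_+ k C 2) (nC1≡n k))

-- Bit lists

ones : List Bool → ℕ
ones []           = 0
ones (true ∷ bs)  = suc (ones bs)
ones (false ∷ bs) = ones bs

zeros : List Bool → ℕ
zeros []           = 0
zeros (true ∷ bs)  = zeros bs
zeros (false ∷ bs) = suc (zeros bs)

-- The sum of the 0-based positions of the bits true: each bit in front of a
-- list shifts all its positions by one.
positionSum : List Bool → ℕ
positionSum []       = 0
positionSum (b ∷ bs) = ones bs + positionSum bs

private variable
  bs bs′ cs : List Bool

-- Both lists start with `q` clear bits. So `unset q cs` encodes a set whose elements all exceed
-- `q`, and passing to `set q cs` adds `q` as its new minimum.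
unset set : ℕ → List Bool → List Bool
unset q cs = replicate q false ++ false ∷ cs
set   q cs = replicate q false ++ true ∷ cs

ones-set : ∀ q → ones (set q cs) ≡ suc (ones (unset q cs))
ones-set zero    = refl
ones-set (suc q) = ones-set q

zeros-unset : ∀ q → zeros (unset q cs) ≡ suc (zeros (set q cs))
zeros-unset zero    = refl
zeros-unset (suc q) = cong suc (zeros-unset q)

length-set : ∀ q → length (set q cs) ≡ length (unset q cs)
length-set zero    = refl
length-set (suc q) = cong suc (length-set q)

-- Each of the `q` leading clear bits contributes the number of ones behind it, and that number is
-- one larger once the bit at `q` is set.
positionSum-set : ∀ q → positionSum (set q cs) ≡ q + positionSum (unset q cs)
positionSum-set      zero    = refl
positionSum-set {cs} (suc q) = begin
  ones (set q cs) + positionSum (set q cs)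
    ≡⟨ cong₂ _+_ (ones-set q) (positionSum-set q) ⟩
  suc (ones (unset q cs)) + (q + positionSum (unset q cs))
    ≡⟨ shuffle (ones (unset q cs)) q (positionSum (unset q cs)) ⟩
  suc q + (ones (unset q cs) + positionSum (unset q cs)) ∎
  where
  open ≡-Reasoning
  shuffle : ∀ a b c → suc a + (b + c) ≡ suc b + (a + c)
  shuffle = solve-∀

unset-injective : ∀ q → unset q bs ≡ unset q bs′ → bs ≡ bs′
unset-injective q eq = ∷-injectiveʳ (++-cancelˡ (replicate q false) _ _ eq)

-- The first true bit reveals `q`, so `q` need not be shared by the two sides. `unset` leaves no
-- such trace, hence the common `q` in `unset-injective`.
set-injective : ∀ q q′ → set q bs ≡ set q′ bs′ → q ≡ q′ × bs ≡ bs′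
set-injective zero    zero     eq = refl , ∷-injectiveʳ eq
set-injective (suc q) (suc q′) eq with set-injective q q′ (∷-injectiveʳ eq)
... | refl , eq′ = refl , eq′

-- Words as shuffles of the letters n with a word of lower letters

module Alphabet (m : ℕ) where

  n : ℕ
  n = 2 + m

  letter : Fin n → ℕ
  letter a = suc (toℕ a)

  one top : Fin n
  one = zero
  top = fromℕ (suc m)

  letter-injective : ∀ {a b} → letter a ≡ letter b → a ≡ b
  letter-injective = toℕ-injective ∘ suc-injective

  letter-top : letter top ≡ n
  letter-top = cong suc (toℕ-fromℕ (suc m))

  letter≤n : ∀ a → letter a ≤ n
  letter≤n a = s≤s (toℕ≤pred[n] a)

  is1? : Decidable (λ a → letter a ≡ 1)
  is1? a = letter a ≟ 1

  non1? : Decidable (λ a → letter a ≢ 1)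
  non1? a = ¬? (letter a ≟ 1)

  isn? : Decidable (λ a → letter a ≡ n)
  isn? a = letter a ≟ n

  non-n? : Decidable (λ a → letter a ≢ n)
  non-n? a = ¬? (letter a ≟ n)

  private variable
    x : Fin n
    u u′ w w′ : List (Fin n)
    q : ℕ

  -- The word w has its letters n at the positions marked in bs, and u is
  -- the word of its other letters.
  data Shuffle : List Bool → List (Fin n) → List (Fin n) → Set where
    []   : Shuffle [] [] []
    top∷ : letter x ≡ n → Shuffle bs u w → Shuffle (true ∷ bs) u (x ∷ w)
    low∷ : letter x ≢ n → Shuffle bs u w → Shuffle (false ∷ bs) (x ∷ u) (x ∷ w)

  -- With `unshuffle-unique`, `shuffle` and `shuffle-unique` this makes the encoding bijective:
  -- words `w` correspond to pairs of a bit list `bs` and an n-free word `u` of length `zeros bs`.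
  unshuffle : ∀ w → ∃[ bs ] ∃[ u ] Shuffle bs u w
  unshuffle []      = [] , [] , []
  unshuffle (x ∷ w) with unshuffle w | letter x ≟ n
  ... | bs , u , s | yes x≡n = true ∷ bs , u , top∷ x≡n s
  ... | bs , u , s | no x≢n  = false ∷ bs , x ∷ u , low∷ x≢n s

  unshuffle-unique : Shuffle bs u w → Shuffle bs′ u′ w → bs ≡ bs′ × u ≡ u′
  unshuffle-unique []           []            = refl , refl
  unshuffle-unique (top∷ x≡n s) (top∷ _ s′)   with unshuffle-unique s s′
  ... | refl , refl = refl , refl
  unshuffle-unique (top∷ x≡n _) (low∷ x≢n _)  = contradiction x≡n x≢n
  unshuffle-unique (low∷ x≢n _) (top∷ x≡n _)  = contradiction x≡n x≢n
  unshuffle-unique (low∷ x≢n s) (low∷ _ s′)   with unshuffle-unique s s′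
  ... | refl , refl = refl , refl

  shuffle-unique : Shuffle bs u w → Shuffle bs u w′ → w ≡ w′
  shuffle-unique []           []            = refl
  shuffle-unique (top∷ x≡n s) (top∷ y≡n s′) =
    cong₂ _∷_ (letter-injective (trans x≡n (sym y≡n))) (shuffle-unique s s′)
  shuffle-unique (low∷ _ s)   (low∷ _ s′)   = cong (_ ∷_) (shuffle-unique s s′)

  shuffle : ∀ bs → ListAll.All (λ a → letter a ≢ n) u → length u ≡ zeros bs → ∃ (Shuffle bs u)
  shuffle []           []            _  = [] , []
  shuffle (true ∷ bs)  low           le = let w , s = shuffle bs low le in top ∷ w , top∷ letter-top s
  shuffle (false ∷ bs) (x≢n ∷ low)   le =
    let w , s = shuffle bs low (suc-injective le) in _ ∷ w , low∷ x≢n s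

  Shuffle⇒low : Shuffle bs u w → ListAll.All (λ a → letter a ≢ n) u
  Shuffle⇒low []           = []
  Shuffle⇒low (top∷ _ s)   = Shuffle⇒low s
  Shuffle⇒low (low∷ x≢n s) = x≢n ∷ Shuffle⇒low s

  length≡zeros : Shuffle bs u w → length u ≡ zeros bs
  length≡zeros []         = refl
  length≡zeros (top∷ _ s) = length≡zeros s
  length≡zeros (low∷ _ s) = cong suc (length≡zeros s)

  length-Shuffle : Shuffle bs u w → length w ≡ length bs
  length-Shuffle []         = refl
  length-Shuffle (top∷ _ s) = cong suc (length-Shuffle s)
  length-Shuffle (low∷ _ s) = cong suc (length-Shuffle s)

  #n≡ones : Shuffle bs u w → length (filter isn? w) ≡ ones bs
  #n≡ones []           = refl
  #n≡ones (top∷ x≡n s) = trans (cong length (filter-accept isn? x≡n)) (cong suc (#n≡ones s))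
  #n≡ones (low∷ x≢n s) = trans (cong length (filter-reject isn? x≢n)) (#n≡ones s)

  filter-Shuffle : ∀ {P : Pred (Fin n) 0ℓ} (P? : Decidable P) → (∀ {a} → letter a ≡ n → ¬ P a) →
                   Shuffle bs u w → filter P? w ≡ filter P? u
  filter-Shuffle P? ¬top []           = refl
  filter-Shuffle P? ¬top (top∷ x≡n s) = trans (filter-reject P? (¬top x≡n)) (filter-Shuffle P? ¬top s)
  filter-Shuffle P? ¬top (low∷ {x} _ s) with P? x
  ... | yes _ = cong (x ∷_) (filter-Shuffle P? ¬top s)
  ... | no _  = filter-Shuffle P? ¬top s

  filter-non-n : Shuffle bs u w → filter non-n? w ≡ u
  filter-non-n s = trans (filter-Shuffle non-n? (λ a≡n a≢n → a≢n a≡n) s) (filter-all non-n? (Shuffle⇒low s))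

  -- The `takeWhile` length is the 0-based position of the first n, or the length of `w` if there is
  -- none. In either case the bound says that the first `q + 1` letters exist and differ from n.
  <-takeWhile⇒unset : Shuffle bs u w → q < length (takeWhile non-n? w) → ∃[ cs ] bs ≡ unset q cs
  <-takeWhile⇒unset [] ()
  <-takeWhile⇒unset {w = x ∷ w} {q = q} (top∷ x≡n s) q< =
    contradiction (subst (q <_) (cong length (takeWhile-reject non-n? {xs = w} (λ x≢n → x≢n x≡n))) q<) λ ()
  <-takeWhile⇒unset {q = zero}  (low∷ _ s) _ = _ , refl
  <-takeWhile⇒unset {w = x ∷ w} {q = suc q} (low∷ x≢n s) q< =
    let cs , eq = <-takeWhile⇒unset s
                    (s≤s⁻¹ (subst (suc q <_) (cong length (takeWhile-accept non-n? {xs = w} x≢n)) q<))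
    in cs , cong (false ∷_) eq

  unset⇒<-takeWhile : ∀ q → Shuffle (unset q cs) u w → q < length (takeWhile non-n? w)
  unset⇒<-takeWhile {w = x ∷ w} zero (low∷ x≢n s) =
    subst (0 <_) (sym (cong length (takeWhile-accept non-n? {xs = w} x≢n))) (s≤s z≤n)
  unset⇒<-takeWhile {w = x ∷ w} (suc q) (low∷ x≢n s) =
    subst (suc q <_) (sym (cong length (takeWhile-accept non-n? {xs = w} x≢n)))
      (s≤s (unset⇒<-takeWhile q s))

  -- Some n must occur: otherwise `takeWhile` runs through all of `w` and its length marks no true
  -- bit.
  ones>0⇒set : Shuffle bs u w → 0 < ones bs → ∃[ cs ] bs ≡ set (length (takeWhile non-n? w)) cs
  ones>0⇒set {w = x ∷ w} (top∷ {bs = bs} x≡n s) _ =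
    bs , cong (λ zs → set (length zs) bs) (sym (takeWhile-reject non-n? {xs = w} (λ x≢n → x≢n x≡n)))
  ones>0⇒set {w = x ∷ w} (low∷ x≢n s) 0< =
    let cs , eq = ones>0⇒set s 0<
    in cs , trans (cong (false ∷_) eq)
                  (cong (λ zs → set (length zs) cs) (sym (takeWhile-accept non-n? {xs = w} x≢n)))

  set⇒takeWhile : ∀ q → Shuffle (set q cs) u w → length (takeWhile non-n? w) ≡ q
  set⇒takeWhile {w = x ∷ w} zero (top∷ x≡n s) =
    cong length (takeWhile-reject non-n? {xs = w} (λ x≢n → x≢n x≡n))
  set⇒takeWhile {w = x ∷ w} (suc q) (low∷ x≢n s) =
    trans (cong length (takeWhile-accept non-n? {xs = w} x≢n)) (cong suc (set⇒takeWhile q s))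

  -- Coinversions of a shuffle

  #larger : Fin n → List (Fin n) → ℕ
  #larger a w = length (filter (λ b → letter a <? letter b) w)

  coinversions : List (Fin n) → ℕ
  coinversions []      = 0
  coinversions (a ∷ w) = #larger a w + coinversions w

  #larger-top : letter x ≡ n → ∀ w → #larger x w ≡ 0
  #larger-top {x} x≡n w = cong length (filter-none (λ b → letter x <? letter b)
    (ListAll.universal (λ b x<b → <⇒≱ x<b (subst (letter b ≤_) (sym x≡n) (letter≤n b))) w))

  #larger-low : letter x ≢ n → Shuffle bs u w → #larger x w ≡ #larger x u + ones bs
  #larger-low x≢n [] = refl
  #larger-low {x} x≢n (top∷ {x = y} {bs = bs} {u} {w} y≡n s) = begin
    #larger x (y ∷ w)            ≡⟨ cong length (filter-accept (λ b → letter x <? letter b)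
                                     (subst (letter x <_) (sym y≡n) (≤∧≢⇒< (letter≤n x) x≢n))) ⟩
    suc (#larger x w)            ≡⟨ cong suc (#larger-low x≢n s) ⟩
    suc (#larger x u + ones bs)  ≡⟨ +-suc _ _ ⟨
    #larger x u + suc (ones bs)  ∎
    where open ≡-Reasoning
  #larger-low {x} x≢n (low∷ {x = y} {u = u} {w} _ s) =
    length-filter-∷ (λ b → letter x <? letter b) y w u (#larger-low x≢n s)

  -- An n at position p with r letters n before it forms p - r coinversions as the larger letter,
  -- and the values r add up to `ones bs C 2`. In the induction, a new first letter shifts every
  -- marked position by one; this is matched by the growth of the binomial if the letter is n, and
  -- by `ones bs` new coinversions otherwise.
  coinversions-Shuffle : Shuffle bs u w → coinversions w + ones bs C 2 ≡ coinversions u + positionSum bs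
  coinversions-Shuffle [] = refl
  coinversions-Shuffle (top∷ {x} {bs} {u} {w} x≡n s) = begin
    #larger x w + coinversions w + suc (ones bs) C 2
      ≡⟨ cong₂ (λ i j → i + coinversions w + j) (#larger-top x≡n w) (suc-C2 (ones bs)) ⟩
    coinversions w + (ones bs + ones bs C 2)
      ≡⟨ lemma₁ (coinversions w) (ones bs) (ones bs C 2) ⟩
    (coinversions w + ones bs C 2) + ones bs
      ≡⟨ cong (_+ ones bs) (coinversions-Shuffle s) ⟩
    (coinversions u + positionSum bs) + ones bs
      ≡⟨ lemma₂ (coinversions u) (positionSum bs) (ones bs) ⟩
    coinversions u + (ones bs + positionSum bs) ∎
    where
    open ≡-Reasoning
    lemma₁ : ∀ a b c → a + (b + c) ≡ (a + c) + b
    lemma₁ = solve-∀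
    lemma₂ : ∀ a b c → (a + b) + c ≡ a + (c + b)
    lemma₂ = solve-∀
  coinversions-Shuffle (low∷ {x} {bs} {u} {w} x≢n s) = begin
    #larger x w + coinversions w + ones bs C 2
      ≡⟨ +-assoc (#larger x w) _ _ ⟩
    #larger x w + (coinversions w + ones bs C 2)
      ≡⟨ cong₂ _+_ (#larger-low x≢n s) (coinversions-Shuffle s) ⟩
    #larger x u + ones bs + (coinversions u + positionSum bs)
      ≡⟨ lemma (#larger x u) (ones bs) (coinversions u) (positionSum bs) ⟩
    #larger x u + coinversions u + (ones bs + positionSum bs) ∎
    where
    open ≡-Reasoning
    lemma : ∀ a b c d → a + b + (c + d) ≡ a + c + (b + d)
    lemma = solve-∀

  -- The 1 is smaller than every letter of the 1-free word `B`, and no letter of `A` is smaller than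
  -- it.
  coinversions-one : ∀ A {B} → ListAll.All (λ a → letter a ≢ 1) B →
                     coinversions (A ++ one ∷ B) ≡ coinversions (A ++ B) + length B
  coinversions-one [] {B} B∌1 = begin
    #larger one B + coinversions B ≡⟨ cong (λ zs → length zs + coinversions B) (filter-all _
                                       (ListAll.map (λ a≢1 → ≤∧≢⇒< (s≤s z≤n) (a≢1 ∘ sym)) B∌1)) ⟩
    length B + coinversions B      ≡⟨ +-comm (length B) _ ⟩
    coinversions B + length B      ∎
    where open ≡-Reasoning
  coinversions-one (x ∷ A) {B} B∌1 = begin
    #larger x (A ++ one ∷ B) + coinversions (A ++ one ∷ B)
      ≡⟨ cong₂ _+_ (cong length (filter-++-reject (λ b → letter x <? letter b) A λ { (s≤s ()) }))
                   (coinversions-one A B∌1) ⟩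
    #larger x (A ++ B) + (coinversions (A ++ B) + length B)
      ≡⟨ +-assoc (#larger x (A ++ B)) _ _ ⟨
    #larger x (A ++ B) + coinversions (A ++ B) + length B ∎
    where open ≡-Reasoning

  -- Cutting a word at its last 1

  split-last-one : ∀ u → ListAll.All (λ a → letter a ≢ 1) u ⊎
                   (∃[ A ] ∃[ B ] (u ≡ A ++ one ∷ B × ListAll.All (λ a → letter a ≢ 1) B))
  split-last-one []      = inj₁ []
  split-last-one (x ∷ u) with split-last-one u
  ... | inj₂ (A , B , eq , B∌1) = inj₂ (x ∷ A , B , cong (x ∷_) eq , B∌1)
  ... | inj₁ u∌1 with letter x ≟ 1
  ...   | yes x≡1 = inj₂ ([] , u , cong (_∷ u) (letter-injective x≡1) , u∌1)
  ...   | no x≢1  = inj₁ (x≢1 ∷ u∌1)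

  split-last-one-unique : ∀ A A′ {B B′} → ListAll.All (λ a → letter a ≢ 1) B →
                          ListAll.All (λ a → letter a ≢ 1) B′ →
                          A ++ one ∷ B ≡ A′ ++ one ∷ B′ → A ≡ A′ × B ≡ B′
  split-last-one-unique []      []        B∌1 B′∌1 refl = refl , refl
  split-last-one-unique []      (_ ∷ A′)  B∌1 B′∌1 refl = contradiction refl (ListAll.head (++⁻ʳ A′ B∌1))
  split-last-one-unique (_ ∷ A) []        B∌1 B′∌1 refl = contradiction refl (ListAll.head (++⁻ʳ A B′∌1))
  split-last-one-unique (x ∷ A) (x′ ∷ A′) B∌1 B′∌1 eq
    with split-last-one-unique A A′ B∌1 B′∌1 (∷-injectiveʳ eq)
  ... | refl , B≡B′ = cong (_∷ A) (∷-injectiveˡ eq) , B≡B′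

  -- Read from the right, the word shows `B` and then the 1, where `takeWhile` stops.
  takeWhile-reverse-one : ∀ A {B} → ListAll.All (λ a → letter a ≢ 1) B →
                          length (takeWhile non1? (reverse (A ++ one ∷ B))) ≡ length B
  takeWhile-reverse-one A {B} B∌1 = begin
    length (takeWhile non1? (reverse (A ++ one ∷ B)))
      ≡⟨ cong (length ∘ takeWhile non1?) (reverse-++ A (one ∷ B)) ⟩
    length (takeWhile non1? (reverse (one ∷ B) ++ reverse A))
      ≡⟨ cong (λ zs → length (takeWhile non1? (zs ++ reverse A))) (unfold-reverse one B) ⟩
    length (takeWhile non1? ((reverse B ++ one ∷ []) ++ reverse A))
      ≡⟨ cong (length ∘ takeWhile non1?) (++-assoc (reverse B) _ _) ⟩
    length (takeWhile non1? (reverse B ++ one ∷ reverse A))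
      ≡⟨ cong length (takeWhile-++ non1? (one ∷ reverse A) (reverse⁺ B∌1)) ⟩
    length (reverse B ++ [])
      ≡⟨ cong length (++-identityʳ (reverse B)) ⟩
    length (reverse B)
      ≡⟨ length-reverse B ⟩
    length B ∎
    where open ≡-Reasoning

  -- Only an inequality, since `A` may itself end in letters other than 1.
  takeWhile-reverse-≥ : ∀ A {B} → ListAll.All (λ a → letter a ≢ 1) B →
                        length B ≤ length (takeWhile non1? (reverse (A ++ B)))
  takeWhile-reverse-≥ A {B} B∌1 = begin
    length B                                              ≡⟨ length-reverse B ⟨
    length (reverse B)                                    ≤⟨ length-++-≤ˡ (reverse B) ⟩
    length (reverse B ++ takeWhile non1? (reverse A))     ≡⟨ cong length (takeWhile-++ non1? (reverse A) (reverse⁺ B∌1)) ⟨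
    length (takeWhile non1? (reverse B ++ reverse A))     ≡⟨ cong (length ∘ takeWhile non1?) (reverse-++ A B) ⟨
    length (takeWhile non1? (reverse (A ++ B)))           ∎
    where open ≤-Reasoning

  -- The graph of φ on words of arbitrary length.
  record _↝_ (w w′ : List (Fin n)) : Set where
    constructor step
    field
      {rest} : List Bool
      A B    : List (Fin n)
      B∌1    : ListAll.All (λ a → letter a ≢ 1) B
      source : Shuffle (unset (length B) rest) (A ++ one ∷ B) w
      target : Shuffle (set (length B) rest) (A ++ B) w′

  -- The source word determines its bits and its lower letters. As `B` contains no 1, the cut lies
  -- at the last 1; this fixes `length B`, and with it `rest`.
  ↝-functional : ∀ {w w₁ w₂} → w ↝ w₁ → w ↝ w₂ → w₁ ≡ w₂
  ↝-functional (step A B B∌1 s t) (step A′ B′ B′∌1 s′ t′) with unshuffle-unique s s′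
  ... | bits≡ , u≡ with split-last-one-unique A A′ B∌1 B′∌1 u≡
  ... | refl , refl with unset-injective (length B) bits≡
  ... | refl = shuffle-unique t t′

  -- No 1 marks the cut in the target. Instead its first true bit gives `length B`, which locates
  -- the cut.
  ↝-injective : ∀ {w₁ w₂ w} → w₁ ↝ w → w₂ ↝ w → w₁ ≡ w₂
  ↝-injective (step A B B∌1 s t) (step A′ B′ B′∌1 s′ t′) with unshuffle-unique t t′
  ... | bits≡ , u≡ with set-injective (length B) (length B′) bits≡
  ... | len≡ , refl with ++-injective-lengthʳ A A′ len≡ u≡
  ... | refl , refl = shuffle-unique s s′

  -- Existence of images and preimages

  -- The positions `pₙ` and `p₁` lowered by one, that is, counted from 0. If the letter sought is
  -- absent, the value is the length of the list searched.
  pₙ-1 p₁-1 : List (Fin n) → ℕ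
  pₙ-1 w = length (takeWhile non-n? w)
  p₁-1 w = length (takeWhile non1? (reverse (filter non-n? w)))

  -- The first hypothesis provides a last 1, followed by `B` among the lower letters. Then `p₁-1 w`
  -- is `length B`, and the second hypothesis says that the bits up to and including this position
  -- are clear.
  ↝-total : ∀ w → 0 < length (filter is1? w) → p₁-1 w < pₙ-1 w → ∃ (w ↝_)
  ↝-total w 0<#1 p₁<pₙ with unshuffle w
  ... | bs , u , s with split-last-one u
  ... | inj₁ u∌1 = contradiction 0<#1 (<⇒≱ (s≤s (≤-reflexive
                     (trans (cong length (filter-Shuffle is1? (λ { p q → 1+n≢0 (suc-injective (trans (sym p) q)) }) s))
                            (cong length (filter-none is1? u∌1))))))
  ... | inj₂ (A , B , refl , B∌1)
    with <-takeWhile⇒unset {q = length B} s (subst (_< pₙ-1 w)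
           (trans (cong (length ∘ takeWhile non1? ∘ reverse) (filter-non-n s)) (takeWhile-reverse-one A B∌1)) p₁<pₙ)
  ... | rest , refl =
    let low = Shuffle⇒low s
        w′ , t = shuffle (set (length B) rest)
                   (++⁺ (++⁻ˡ A low) (ListAll.tail (++⁻ʳ A low)))
                   -- Deleting the 1 and setting a clear bit lower the two sizes by one each, so the
                   -- letters still fit the clear bits.
                   (suc-injective (begin
                     suc (length (A ++ B))           ≡⟨ length-++-sucʳ A one B ⟨
                     length (A ++ one ∷ B)           ≡⟨ length≡zeros s ⟩
                     zeros (unset (length B) rest)   ≡⟨ zeros-unset (length B) ⟩
                     suc (zeros (set (length B) rest)) ∎))
    in w′ , step A B B∌1 s t
    where open ≡-Reasoning

  -- The first n stands at `pₙ-1 w`, and the inequality says that this many letters at the end of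
  -- `u` are free of 1. They form `B`; a 1 is put before them and the bit of the first n is cleared.
  ↝-surjective : ∀ w → 0 < length (filter isn? w) → pₙ-1 w ≤ p₁-1 w → ∃ (_↝ w)
  ↝-surjective w 0<#n pₙ≤p₁ with unshuffle w
  ... | bs , u , t with ones>0⇒set t (subst (0 <_) (#n≡ones t) 0<#n)
  ... | rest , eq
    with ≤-takeWhile⇒prefix non1? (reverse u)
           (subst (pₙ-1 w ≤_) (cong (length ∘ takeWhile non1? ∘ reverse) (filter-non-n t)) pₙ≤p₁)
  ... | ys , zs , rev≡ , len , ys∌1 = proj₁ sh , step A B (reverse⁺ ys∌1) (proj₂ sh) t′
    where
    open ≡-Reasoning
    A = reverse zs
    B = reverse ys
    u≡ : u ≡ A ++ B
    u≡ = begin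
      u                   ≡⟨ reverse-involutive u ⟨
      reverse (reverse u) ≡⟨ cong reverse rev≡ ⟩
      reverse (ys ++ zs)  ≡⟨ reverse-++ ys zs ⟩
      A ++ B              ∎
    t′ : Shuffle (set (length B) rest) (A ++ B) w
    t′ = subst₂ (λ bs u → Shuffle bs u w)
           (trans eq (cong (λ q → set q rest) (sym (trans (length-reverse ys) len)))) u≡ t
    low = Shuffle⇒low t′
    sh = shuffle (unset (length B) rest)
           -- The inserted 1 is not n, because n is at least 2.
           (++⁺ (++⁻ˡ A low) ((λ ()) ∷ ++⁻ʳ A low))
           (begin
             length (A ++ one ∷ B)             ≡⟨ length-++-sucʳ A one B ⟩
             suc (length (A ++ B))             ≡⟨ cong suc (length≡zeros t′) ⟩
             suc (zeros (set (length B) rest)) ≡⟨ zeros-unset (length B) ⟨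
             zeros (unset (length B) rest)     ∎)

  -- Positions, letter counts and coinversions along a step

  ↝-source : w ↝ w′ → p₁-1 w < pₙ-1 w
  ↝-source {w} (step A B B∌1 s t) = subst (_< pₙ-1 w)
    (sym (trans (cong (length ∘ takeWhile non1? ∘ reverse) (filter-non-n s)) (takeWhile-reverse-one A B∌1)))
    (unset⇒<-takeWhile (length B) s)

  ↝-target : w ↝ w′ → pₙ-1 w′ ≤ p₁-1 w′
  ↝-target {w} {w′} (step A B B∌1 s t) = begin
    pₙ-1 w′                                      ≡⟨ set⇒takeWhile (length B) t ⟩
    length B                                     ≤⟨ takeWhile-reverse-≥ A B∌1 ⟩
    length (takeWhile non1? (reverse (A ++ B)))  ≡⟨ cong (length ∘ takeWhile non1? ∘ reverse) (filter-non-n t) ⟨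
    p₁-1 w′                                      ∎
    where open ≤-Reasoning

  ↝-length : w ↝ w′ → length w ≡ length w′
  ↝-length (step A B _ s t) = trans (length-Shuffle s) (trans (sym (length-set (length B))) (sym (length-Shuffle t)))

  ↝-#n : w ↝ w′ → length (filter isn? w′) ≡ suc (length (filter isn? w))
  ↝-#n (step A B _ s t) = trans (#n≡ones t) (trans (ones-set (length B)) (cong suc (sym (#n≡ones s))))

  ↝-#1 : w ↝ w′ → length (filter is1? w) ≡ suc (length (filter is1? w′))
  ↝-#1 {w} {w′} (step A B _ s t) = begin
    length (filter is1? w)                ≡⟨ cong length (filter-Shuffle is1? n≢1 s) ⟩
    length (filter is1? (A ++ one ∷ B))   ≡⟨ length-filter-++-accept is1? A refl ⟩
    suc (length (filter is1? (A ++ B)))   ≡⟨ cong (suc ∘ length) (filter-Shuffle is1? n≢1 t) ⟨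
    suc (length (filter is1? w′))         ∎
    where
    open ≡-Reasoning
    n≢1 : ∀ {a} → letter a ≡ n → letter a ≢ 1
    n≢1 p q = 1+n≢0 (suc-injective (trans (sym p) q))

  ↝-filter : ∀ {P : Pred (Fin n) 0ℓ} (P? : Decidable P) → (∀ {a} → letter a ≡ n → ¬ P a) → ¬ P one →
             w ↝ w′ → filter P? w ≡ filter P? w′
  ↝-filter {w} {w′} P? ¬top ¬one (step A B _ s t) = begin
    filter P? w              ≡⟨ filter-Shuffle P? ¬top s ⟩
    filter P? (A ++ one ∷ B) ≡⟨ filter-++-reject P? A ¬one ⟩
    filter P? (A ++ B)       ≡⟨ filter-Shuffle P? ¬top t ⟨
    filter P? w′             ∎
    where open ≡-Reasoning

  -- The `length B` coinversions lost with the deleted 1 reappear in the position sum as the newly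
  -- marked position.
  ↝-coinversions : w ↝ w′ → coinversions w′ + length (filter isn? w′) C 2 ≡
                            coinversions w + length (filter isn? w) C 2
  ↝-coinversions {w} {w′} (step {rest} A B B∌1 s t) = begin
    coinversions w′ + length (filter isn? w′) C 2
      ≡⟨ cong (λ k → coinversions w′ + k C 2) (#n≡ones t) ⟩
    coinversions w′ + ones (set (length B) rest) C 2
      ≡⟨ coinversions-Shuffle t ⟩
    coinversions (A ++ B) + positionSum (set (length B) rest)
      ≡⟨ cong (coinversions (A ++ B) +_) (positionSum-set (length B)) ⟩
    coinversions (A ++ B) + (length B + positionSum (unset (length B) rest))
      ≡⟨ +-assoc (coinversions (A ++ B)) _ _ ⟨
    coinversions (A ++ B) + length B + positionSum (unset (length B) rest)
      ≡⟨ cong (_+ positionSum (unset (length B) rest)) (coinversions-one A B∌1) ⟨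
    coinversions (A ++ one ∷ B) + positionSum (unset (length B) rest)
      ≡⟨ coinversions-Shuffle s ⟨
    coinversions w + ones (unset (length B) rest) C 2
      ≡⟨ cong (λ k → coinversions w + k C 2) (#n≡ones s) ⟨
    coinversions w + length (filter isn? w) C 2 ∎
    where open ≡-Reasoning

  -- Makes the convention for `W>[ 0 ]` an instance of the general inequality: without n, `pₙ-1 w`
  -- is the length of `w`, which exceeds the number of letters behind the last 1.
  #1>0∧#n≡0⇒p₁<pₙ : ∀ w → 0 < length (filter is1? w) → length (filter isn? w) ≡ 0 → p₁-1 w < pₙ-1 w
  #1>0∧#n≡0⇒p₁<pₙ w 0<#1 #n≡0 with split-last-one w
  ... | inj₁ w∌1 = contradiction (cong length (filter-none is1? w∌1)) (>⇒≢ 0<#1)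
  ... | inj₂ (A , B , refl , B∌1) = begin-strict
    p₁-1 w                                             ≡⟨ cong (length ∘ takeWhile non1? ∘ reverse) (filter-all non-n? w∌n) ⟩
    length (takeWhile non1? (reverse (A ++ one ∷ B)))  ≡⟨ takeWhile-reverse-one A B∌1 ⟩
    length B                                           <⟨ length-++-≤ʳ (one ∷ B) {A} ⟩
    length w                                           ≡⟨ cong length (all⇒takeWhile≗id non-n? w∌n) ⟨
    pₙ-1 w                                             ∎
    where
    open ≤-Reasoning
    w∌n = length-filter≡0⇒All¬ isn? w #n≡0

  -- The same for the convention at level `L`: without 1, `p₁-1 w` counts all letters other than n,
  -- among them those before the first n.
  #1≡0⇒pₙ≤p₁ : ∀ w → length (filter is1? w) ≡ 0 → pₙ-1 w ≤ p₁-1 w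
  #1≡0⇒pₙ≤p₁ w #1≡0 = begin
    pₙ-1 w                              ≤⟨ takeWhile≤filter non-n? w ⟩
    length (filter non-n? w)            ≡⟨ length-reverse (filter non-n? w) ⟨
    length (reverse (filter non-n? w))  ≡⟨ cong length (all⇒takeWhile≗id non1?
                                             (reverse⁺ (filter⁺ non-n? (length-filter≡0⇒All¬ is1? w #1≡0)))) ⟨
    p₁-1 w                              ∎
    where open ≤-Reasoning

  -- The index pairs are grouped by their left index. Row zero counts the letters larger than the
  -- first one, and the other rows are those of the tail.
  coinv≡coinversions : ∀ {N} (α : Vec ℕ m) (w : Vec (Fin n) N) →
                       Words.coinv n N α w ≡ coinversions (toList w)
  coinv≡coinversions α w =
    trans (length-filter-cartesianProduct (λ (i , j) → pair? w i j) (allFin _) (allFin _)) (rows w)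
    where
    open ≡-Reasoning
    pair? : ∀ {N} (w : Vec (Fin n) N) (i j : Fin N) →
            Dec (toℕ i < toℕ j × letter (lookup w i) < letter (lookup w j))
    pair? w i j = (toℕ i <? toℕ j) ×-dec (letter (lookup w i) <? letter (lookup w j))

    row : ∀ {N} → Vec (Fin n) N → Fin N → ℕ
    row {N} w i = length (filter (pair? w i) (allFin N))

    row-zero : ∀ {N} x (w : Vec (Fin n) N) → row (x ∷ w) zero ≡ #larger x (toList w)
    row-zero x w = begin
      row (x ∷ w) zero
        ≡⟨ length-filter-allFin-suc (pair? (x ∷ w) zero) (λ ()) ⟩
      length (filter (λ j → pair? (x ∷ w) zero (suc j)) (allFin _))
        ≡⟨ cong length (filter-≐ _ (λ j → letter x <? letter (lookup w j)) (proj₂ , (s≤s z≤n ,_)) (allFin _)) ⟩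
      length (filter (λ j → letter x <? letter (lookup w j)) (allFin _))
        ≡⟨ length-filter-map (λ b → letter x <? letter b) (lookup w) (allFin _) ⟨
      #larger x (List.map (lookup w) (allFin _))
        ≡⟨ cong (#larger x) (map-lookup-allFin w) ⟩
      #larger x (toList w) ∎

    row-suc : ∀ {N} x (w : Vec (Fin n) N) i → row (x ∷ w) (suc i) ≡ row w i
    row-suc x w i = trans
      (length-filter-allFin-suc (pair? (x ∷ w) (suc i)) (λ ()))
      (cong length (filter-≐ _ (pair? w i) ((λ (p , q) → s≤s⁻¹ p , q) , (λ (p , q) → s≤s p , q)) (allFin _)))

    rows : ∀ {N} (w : Vec (Fin n) N) → ListAction.sum (List.map (row w) (allFin N)) ≡ coinversions (toList w)
    rows []      = refl
    rows (x ∷ w) = cong₂ _+_ (row-zero x w) (begin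
      ListAction.sum (List.map (row (x ∷ w)) (tabulate suc)) ≡⟨ cong ListAction.sum (map-tabulate suc (row (x ∷ w))) ⟩
      ListAction.sum (tabulate (row (x ∷ w) ∘ suc))          ≡⟨ cong ListAction.sum (tabulate-cong (row-suc x w)) ⟩
      ListAction.sum (tabulate (row w))                      ≡⟨ cong ListAction.sum (map-tabulate id (row w)) ⟨
      ListAction.sum (List.map (row w) (allFin _))           ≡⟨ rows w ⟩
      coinversions (toList w)                                ∎)

-- Transfer to the levels of fixed-length words

module Bijectivity (m N ℓ : ℕ) (α : Vec ℕ m) (Σα<N : sum α < N) where

  open Alphabet m
  open Words n N α hiding (letter)

  private variable
    k : ℕ
    w w′ : Word

  _⟶_ : Word → Word → Set
  w ⟶ w′ = toList w ↝ toList w′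

  #≡ : ∀ i w → #[ i ] w ≡ length (filter (λ a → letter a ≟ i) (toList w))
  #≡ i = count≡length-filter (λ a → letter a ≟ i)

  0<L : 0 < L
  0<L = m<n⇒0<n∸m Σα<N

  ⟶-#n : w ⟶ w′ → #[ n ] w′ ≡ suc (#[ n ] w)
  ⟶-#n {w} {w′} r = trans (#≡ n w′) (trans (↝-#n r) (cong suc (sym (#≡ n w))))

  ⟶-#1 : w ⟶ w′ → #[ 1 ] w ≡ suc (#[ 1 ] w′)
  ⟶-#1 {w} {w′} r = trans (#≡ 1 w) (trans (↝-#1 r) (cong suc (sym (#≡ 1 w′))))

  ⟶-#i : w ⟶ w′ → ∀ (j : Fin m) → #[ 2 + toℕ j ] w ≡ #[ 2 + toℕ j ] w′
  ⟶-#i {w} {w′} r j = begin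
    #[ 2 + toℕ j ] w                                         ≡⟨ #≡ (2 + toℕ j) w ⟩
    length (filter (λ a → letter a ≟ 2 + toℕ j) (toList w))   ≡⟨ cong length (↝-filter (λ a → letter a ≟ 2 + toℕ j)
      (λ a≡n a≡j → <⇒≢ (s≤s (s≤s (toℕ<n j))) (trans (sym a≡j) a≡n)) (λ ()) r) ⟩
    length (filter (λ a → letter a ≟ 2 + toℕ j) (toList w′))  ≡⟨ #≡ (2 + toℕ j) w′ ⟨
    #[ 2 + toℕ j ] w′                                        ∎
    where open ≡-Reasoning

  W-forward : w ⟶ w′ → k < L → W[ k ] w → W[ suc k ] w′
  W-forward {w} {w′} {k} r k<L ∈W = record
    { k≤L     = k<L
    ; count-n = trans (⟶-#n {w} r) (cong suc count-n)
    ; count-1 = suc-injective (begin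
        suc (#[ 1 ] w′)  ≡⟨ ⟶-#1 {w} r ⟨
        #[ 1 ] w         ≡⟨ count-1 ⟩
        -- The left side is `suc L ∸ suc k` by computation, and `k<L` keeps the truncated
        -- subtraction exact.
        L ∸ k            ≡⟨ +-∸-assoc 1 k<L ⟩
        suc (L ∸ suc k)  ∎)
    ; count-i = λ j → trans (sym (⟶-#i {w} {w′} r j)) (count-i j)
    }
    where
    open W[_] ∈W
    open ≡-Reasoning

  W-backward : w ⟶ w′ → W[ suc k ] w′ → W[ k ] w
  W-backward {w} {w′} {k} r ∈W = record
    { k≤L     = <⇒≤ k≤L
    ; count-n = suc-injective (trans (sym (⟶-#n {w} r)) count-n)
    ; count-1 = begin
        #[ 1 ] w         ≡⟨ ⟶-#1 {w} r ⟩
        suc (#[ 1 ] w′)  ≡⟨ cong suc count-1 ⟩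
        suc (L ∸ suc k)  ≡⟨ +-∸-assoc 1 k≤L ⟨
        L ∸ k            ∎
    ; count-i = λ j → trans (⟶-#i {w} {w′} r j) (count-i j)
    }
    where
    open W[_] ∈W
    open ≡-Reasoning

  -- Level 0 carries no inequality of its own; there the bound is `0<L`, which comes from `Σα<N`.
  W>⇒<L : W>[ k ] w → k < L
  W>⇒<L (_ , inj₁ refl)          = 0<L
  W>⇒<L (_ , inj₂ (_ , k<L , _)) = k<L

  W≤⇒>0 : W≤[ k ] w → 0 < k
  W≤⇒>0 (_ , inj₁ refl)      = 0<L
  W≤⇒>0 (_ , inj₂ (0<k , _)) = 0<k

  W≤-image : w ⟶ w′ → W>[ k ] w → W≤[ suc k ] w′
  W≤-image {k = k} r w∈@(∈W , _) with m≤n⇒m<n∨m≡n (W>⇒<L w∈)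
  -- The image reaches the top level, where membership is by convention.
  ... | inj₂ 1+k≡L = W-forward r (W>⇒<L w∈) ∈W , inj₁ 1+k≡L
  ... | inj₁ 1+k<L = W-forward r (W>⇒<L w∈) ∈W , inj₂ (s≤s z≤n , 1+k<L , s≤s (↝-target r))

  W>-preimage : w ⟶ w′ → W≤[ suc k ] w′ → W>[ k ] w
  W>-preimage {k = zero}  r (∈W , _) = W-backward r ∈W , inj₁ refl
  W>-preimage {k = suc k} r (∈W , _) =
    -- Here `∈W` is membership at level `suc (suc k)`, so its bound is already `suc k < L`.
    W-backward r ∈W , inj₂ (s≤s z≤n , W[_].k≤L ∈W , s≤s (↝-source r))

  image : W>[ k ] w → ∃ (w ⟶_)
  image {k} {w} w∈@(∈W , cond) =
    let w′ , r   = ↝-total (toList w) 0<#1 (p₁<pₙ cond)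
        w″ , eq  = toList-surjective w′ (trans (sym (↝-length r)) (length-toList w))
    in w″ , subst (toList w ↝_) (sym eq) r
    where
    open W[_] ∈W
    0<#1 : 0 < length (filter is1? (toList w))
    0<#1 = subst (0 <_) (trans (sym count-1) (#≡ 1 w)) (m<n⇒0<n∸m (W>⇒<L w∈))
    p₁<pₙ : k ≡ 0 ⊎ (0 < k × k < L × p₁ w < pₙ w) → p₁-1 (toList w) < pₙ-1 (toList w)
    p₁<pₙ (inj₁ k≡0)             = #1>0∧#n≡0⇒p₁<pₙ (toList w) 0<#1 (trans (sym (#≡ n w)) (trans count-n k≡0))
    p₁<pₙ (inj₂ (_ , _ , s≤s p)) = p

  preimage : W≤[ k ] w′ → ∃ (_⟶ w′)
  preimage {k} {w′} w′∈@(∈W , cond) =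
    let w , r   = ↝-surjective (toList w′) 0<#n (pₙ≤p₁ cond)
        w″ , eq = toList-surjective w (trans (↝-length r) (length-toList w′))
    in w″ , subst (_↝ toList w′) (sym eq) r
    where
    open W[_] ∈W
    0<#n : 0 < length (filter isn? (toList w′))
    0<#n = subst (0 <_) (trans (sym count-n) (#≡ n w′)) (W≤⇒>0 w′∈)
    pₙ≤p₁ : k ≡ L ⊎ (0 < k × k < L × pₙ w′ ≤ p₁ w′) → pₙ-1 (toList w′) ≤ p₁-1 (toList w′)
    pₙ≤p₁ (inj₁ refl)            = #1≡0⇒pₙ≤p₁ (toList w′) (trans (sym (#≡ 1 w′)) (trans count-1 (n∸n≡0 L)))
    pₙ≤p₁ (inj₂ (_ , _ , s≤s p)) = p

  -- The bijection and its properties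

  φ : Σ[ w ∈ Word ] W> w → Σ[ w ∈ Word ] W≤ w
  φ (w , k , w∈) = let w′ , r = image w∈ in w′ , suc k , W≤-image r w∈

  φ-graph : ∀ x → proj₁ x ⟶ proj₁ (φ x)
  φ-graph (w , k , w∈) = proj₂ (image w∈)

  -- Equal words may come with different levels and membership proofs; as `_↝_` relates bare words
  -- and is functional, the images agree.
  φ-cong : ∀ {x y} → proj₁ x ≡ proj₁ y → proj₁ (φ x) ≡ proj₁ (φ y)
  φ-cong {x} {y} refl = toList-injective′ (↝-functional (φ-graph x) (φ-graph y))

  φ-injective : ∀ {x y} → proj₁ (φ x) ≡ proj₁ (φ y) → proj₁ x ≡ proj₁ y
  φ-injective {x} {y} eq = toList-injective′
    (↝-injective (φ-graph x) (subst (λ w → toList (proj₁ y) ↝ toList w) (sym eq) (φ-graph y)))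

  φ-surjective : W≤[ suc k ] w′ → Σ[ x ∈ Σ[ w ∈ Word ] W> w ] (W>[ k ] (proj₁ x) × proj₁ (φ x) ≡ w′)
  φ-surjective {k} {w′} w′∈ =
    let w , r = preimage w′∈
        w∈    = W>-preimage r w′∈
        x     = w , k , w∈
    in x , w∈ , toList-injective′ (↝-functional (φ-graph x) r)

  φ-bijection : Bijection (SubsetSetoid W>) (SubsetSetoid W≤)
  φ-bijection = record
    { to        = φ
    ; cong      = λ {x} {y} → φ-cong {x} {y}
    ; bijective = (λ {x} {y} → φ-injective {x} {y}) , surjective
    }
    where
    surjective : ∀ y → Σ[ x ∈ Σ[ w ∈ Word ] W> w ]
                   (∀ {z} → proj₁ z ≡ proj₁ x → proj₁ (φ z) ≡ proj₁ y)
    -- `W≤[ 0 ]` is empty: even its convention would require `0 ≡ L`, against `0<L`.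
    surjective (w′ , zero  , w′∈) = contradiction (W≤⇒>0 w′∈) λ ()
    surjective (w′ , suc k , w′∈) =
      let x , _ , φx≡w′ = φ-surjective w′∈
      in x , λ {z} z≡x → trans (φ-cong {z} {x} z≡x) φx≡w′

  φ-level : ∀ k → MapsBijectivelyOnto φ W>[ k ] W≤[ suc k ]
  φ-level k = record
    { mapsTo     = λ x w∈ → W≤-image (φ-graph x) w∈
    ; injective  = λ x y _ _ → φ-injective {x} {y}
    ; surjective = λ _ → φ-surjective
    }

  -- The middle sum `S` depends only on `α` and `ℓ`, so it remains to compare `coinv` plus the
  -- binomial of the number of letters n.
  φ-quinv′ : ∀ x → quinv′ ℓ (proj₁ (φ x)) ≡ quinv′ ℓ (proj₁ x)
  φ-quinv′ x = begin
    coinv v′ + S + #[ n ] v′ C 2          ≡⟨ swap (coinv v′) S _ ⟩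
    coinv v′ + #[ n ] v′ C 2 + S          ≡⟨ cong (_+ S) (cong₂ (λ c k → c + k C 2) (coinv≡coinversions α v′) (#≡ n v′)) ⟩
    coinversions (toList v′) + length (filter isn? (toList v′)) C 2 + S
                                          ≡⟨ cong (_+ S) (↝-coinversions (φ-graph x)) ⟩
    coinversions (toList v) + length (filter isn? (toList v)) C 2 + S
                                          ≡⟨ cong (_+ S) (cong₂ (λ c k → c + k C 2) (coinv≡coinversions α v) (#≡ n v)) ⟨
    coinv v + #[ n ] v C 2 + S            ≡⟨ swap (coinv v) _ S ⟩
    coinv v + S + #[ n ] v C 2            ∎
    where
    open ≡-Reasoning
    v = proj₁ x
    v′ = proj₁ (φ x)
    S = ListAction.sum (List.map (λ j → lookup α j C 2) (filter (λ j → ℓ ≤? 2 + toℕ j) (allFin m)))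
    swap : ∀ a b c → a + b + c ≡ a + c + b
    swap = solve-∀

  φ-middleSubword : ∀ x → middleSubword (proj₁ x) ≡ middleSubword (proj₁ (φ x))
  φ-middleSubword x = ↝-filter (λ a → (2 ≤? letter a) ×-dec (letter a ≤? n ∸ 1))
    (λ { a≡n (_ , a<n) → <⇒≢ (s≤s a<n) a≡n }) (λ { (s≤s () , _) }) (φ-graph x)

mainTheorem16 : (n N ℓ : ℕ) (α : Vec ℕ (n ∸ 2)) →
    3 ≤ n → All (1 ≤_) α → sum α < N → 2 ≤ ℓ → ℓ ≤ n →
    let open Words n N α in
    Σ[ φ ∈ Bijection (SubsetSetoid W>) (SubsetSetoid W≤) ]
    ((∀ k → k ≤ L ∸ 1 → MapsBijectivelyOnto (Bijection.to φ) W>[ k ] W≤[ suc k ])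
    × (∀ w → quinv′ ℓ (proj₁ (Bijection.to φ w)) ≡ quinv′ ℓ (proj₁ w))
    × (∀ w → middleSubword (proj₁ w) ≡ middleSubword (proj₁ (Bijection.to φ w))))
-- Matching on two successors lets `n ∸ 2` reduce to `m`, as the type of `α` in `Bijectivity`
-- demands.
mainTheorem16 (suc (suc m)) N ℓ α 3≤n α≥1 Σα<N 2≤ℓ ℓ≤n =
  φ-bijection , (λ k _ → φ-level k) , φ-quinv′ , φ-middleSubword
  where open Bijectivity m N ℓ α Σα<N
mainTheorem16 (suc zero) _ _ _ (s≤s ())
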